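{- Let $G$ be a $3$-free digraph on $n$ vertices. Then $P_4(G) \leq \frac{4}{75}n^4$.
   Context: All digraphs are finite and simple (no loops, no multiple edges). A digraph is $3$-free if it has no directed cycle of length at most $3$. $P_4(G)$ denotes the number of $4$-vertex directed paths in $G$, i.e. the number of sequences $(v_1,v_2,v_3,v_4)$ of distinct vertices with $v_iv_{i+1}\in E(G)$ for $i=1,2,3$. -}

module Defs where

open import Data.Nat using (ℕ; _+_)
open import Data.Fin using (Fin)
open import Data.Fin.Properties using (_≟_)
open import Data.Bool using (Bool; true; false; _∧_; not)
open import Data.List using (List; map; allFin)
open import Data.Nat.ListAction using (sum)
open import Data.Empty using (⊥)
open import Data.Product using (_×_)
open import Relation.Binary.PropositionalEquality using (_≡_)
open import Relation.Nullary.Decidable using (⌊_⌋)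

-- A digraph on vertex set Fin n: a Boolean adjacency relation.
-- Simplicity (no loops) is a hypothesis; multiple edges are impossible
-- by construction. Antiparallel pairs u→v, v→u are allowed in a digraph.
record Digraph (n : ℕ) : Set where
  field
    E       : Fin n → Fin n → Bool
    loopless : ∀ v → E v v ≡ false
open Digraph public

-- Directed cycle of length 2 or 3 (length 1 = loop, excluded by looplessness).
-- 3-free: no directed cycle of length at most 3.
ThreeFree : ∀ {n} → Digraph n → Set
ThreeFree {n} G =
  (∀ (u v : Fin n) → E G u v ≡ true → E G v u ≡ true → ⊥)
  × (∀ (u v w : Fin n) → E G u v ≡ true → E G v w ≡ true → E G w u ≡ true → ⊥)

distinct : ∀ {n} → Fin n → Fin n → Bool
distinct a b = not ⌊ a ≟ b ⌋

isP4 : ∀ {n} → Digraph n → Fin n → Fin n → Fin n → Fin n → Bool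
isP4 G a b c d =
  distinct a b ∧ distinct a c ∧ distinct a d ∧ distinct b c ∧ distinct b d ∧ distinct c d
  ∧ E G a b ∧ E G b c ∧ E G c d

count : Bool → ℕ
count true = 1
count false = 0

P4 : ∀ {n} → Digraph n → ℕ
P4 {n} G = sum (map (λ a → sum (map (λ b → sum (map (λ c → sum (map (λ d →
  count (isP4 G a b c d)) (allFin n))) (allFin n))) (allFin n))) (allFin n))

{-# OPTIONS --safe #-}
module Submission where

-- Relax P4 to the number of walks a → b → c → d. For an edge a → b and a nonadjacent
-- pair a, b (possibly a = b), respectively, the squares of
--   Σ_c ([c → a, c ≁ b] − [b → c, a ≁ c])   and   Σ_c ([a ∼ c] + [b ∼ c] − 3 [a ∼ c][b ∼ c])
-- are nonnegative. Subtracting 126 times the first squares and 21 times the second ones from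
-- 16 n⁴ − 300 · #walks leaves a sum over quadruples of vertices of a function of the digraph
-- they induce; after averaging over the orderings of the quadruple this function is nonnegative
-- on each of the finitely many 3-free digraphs on four vertices. Quadruples with repetitions
-- need no separate treatment: equal vertices behave like nonadjacent twins. The two squares and
-- their weights were found by semidefinite programming (flag algebras) and rounding.

import Algebra.Properties.Semiring.Sum
open import Data.Bool using (Bool; true; false; _∧_; _∨_; not)
open import Data.Bool.Properties using (T-≡; ∧-conicalˡ; ∧-conicalʳ)
open import Data.Empty using (⊥-elim)
open import Data.Fin using (Fin; zero; suc)
open import Data.Fin.Patterns using (0F; 1F; 2F; 3F)
open import Data.Integer as ℤ using (ℤ; +_; 0ℤ; 1ℤ; _≤ᵇ_)
import Data.Integer
import Data.Integer.Properties as ℤₚ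
open import Data.Integer.Tactic.RingSolver using (solve-∀)
open import Data.List using (map; allFin; tabulate)
open import Data.List.Properties using (map-tabulate)
open import Data.Nat as ℕ using (ℕ; _^_)
open import Data.Nat.ListAction using (sum)
import Data.Nat.Properties as ℕₚ
open import Data.Product using (proj₁; proj₂)
open import Data.Vec using (Vec; []; _∷_)
open import Function using (_∘_; id)
open import Function.Bundles using (Equivalence)
open import Relation.Binary.PropositionalEquality using (_≡_; refl; sym; trans; cong; cong₂; subst; _≗_; module ≡-Reasoning)

open import Defs

module Sum = Algebra.Properties.Semiring.Sum ℤₚ.+-*-semiring

private variable
  n : ℕ
  V : Set

-- Sums over vertices and over quadruples of vertices

Weight : Set → Set
Weight V = V → V → V → V → ℤ

module _ where
  open Data.Integer using (_+_; _*_)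

  -- Opaque, since unification cannot infer the summand once sums unfold.
  opaque
    ∑ : (Fin n → ℤ) → ℤ
    ∑ = Sum.sum

    ∑-cong : {f g : Fin n → ℤ} → f ≗ g → ∑ f ≡ ∑ g
    ∑-cong = Sum.sum-cong-≗

    ∑-+ : (f g : Fin n → ℤ) → ∑ (λ i → f i + g i) ≡ ∑ f + ∑ g
    ∑-+ = Sum.∑-distrib-+

    *-∑ : ∀ k (f : Fin n → ℤ) → k * ∑ f ≡ ∑ (λ i → k * f i)
    *-∑ = Sum.*-distribˡ-sum

    ∑-* : ∀ k (f : Fin n → ℤ) → ∑ f * k ≡ ∑ (λ i → f i * k)
    ∑-* = Sum.*-distribʳ-sum

    ∑-swap : (f : Fin n → Fin n → ℤ) → ∑ (λ i → ∑ λ j → f j i) ≡ ∑ (λ i → ∑ (f i))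
    ∑-swap f = sym (Sum.∑-comm f)

    ∑-mono : {f g : Fin n → ℤ} → (∀ i → f i ℤ.≤ g i) → ∑ f ℤ.≤ ∑ g
    ∑-mono {ℕ.zero}  _   = ℤₚ.≤-refl
    ∑-mono {ℕ.suc n} f≤g = ℤₚ.+-mono-≤ (f≤g zero) (∑-mono (f≤g ∘ suc))

    ∑-const : ∀ n k → ∑ {n} (λ _ → k) ≡ + n * k
    ∑-const ℕ.zero    k = sym (ℤₚ.*-zeroˡ k)
    ∑-const (ℕ.suc n) k = trans (cong (λ x → k + x) (∑-const n k)) (sym (ℤₚ.suc-* (+ n) k))

    ∑-pos : (f : Fin n → ℕ) → ∑ (λ i → + f i) ≡ + sum (map f (allFin n))
    ∑-pos {n} f = trans (go f) (cong (λ xs → + sum xs) (sym (map-tabulate id f)))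
      where
      go : ∀ {n} (f : Fin n → ℕ) → Sum.sum (λ i → + f i) ≡ + sum (tabulate f)
      go {ℕ.zero}  f = refl
      go {ℕ.suc n} f = cong (λ x → + f zero + x) (go (f ∘ suc))

  ∑-nonneg : {f : Fin n → ℤ} → (∀ i → 0ℤ ℤ.≤ f i) → 0ℤ ℤ.≤ ∑ f
  ∑-nonneg {n} {f} 0≤f = subst (ℤ._≤ ∑ f) (trans (∑-const n 0ℤ) (ℤₚ.*-zeroʳ (+ n))) (∑-mono 0≤f)

  opaque
    ∑⁴ : Weight (Fin n) → ℤ
    ∑⁴ f = ∑ λ a → ∑ λ b → ∑ λ c → ∑ λ d → f a b c d

    ∑⁴-mono : {f g : Weight (Fin n)} → (∀ a b c d → f a b c d ℤ.≤ g a b c d) → ∑⁴ f ℤ.≤ ∑⁴ g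
    ∑⁴-mono f≤g = ∑-mono λ a → ∑-mono λ b → ∑-mono λ c → ∑-mono λ d → f≤g a b c d

    ∑⁴-nonneg : {f : Weight (Fin n)} → (∀ a b c d → 0ℤ ℤ.≤ f a b c d) → 0ℤ ℤ.≤ ∑⁴ f
    ∑⁴-nonneg 0≤f = ∑-nonneg λ a → ∑-nonneg λ b → ∑-nonneg λ c → ∑-nonneg λ d → 0≤f a b c d

    ∑⁴-+ : (f g : Weight (Fin n)) → ∑⁴ (λ a b c d → f a b c d + g a b c d) ≡ ∑⁴ f + ∑⁴ g
    ∑⁴-+ f g =
      trans (∑-cong λ a →
        trans (∑-cong λ b →
          trans (∑-cong λ c → ∑-+ _ _) (∑-+ _ _))
        (∑-+ _ _))
      (∑-+ _ _)

    *-∑⁴ : ∀ k (f : Weight (Fin n)) → k * ∑⁴ f ≡ ∑⁴ (λ a b c d → k * f a b c d)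
    *-∑⁴ k f =
      trans (*-∑ k _) (∑-cong λ a →
        trans (*-∑ k _) (∑-cong λ b →
          trans (*-∑ k _) (∑-cong λ c → *-∑ k _)))

    ∑⁴-const : ∀ n k → ∑⁴ {n} (λ _ _ _ _ → k) ≡ + (n ^ 4) * k
    ∑⁴-const n k = begin
      ∑⁴ {n} (λ _ _ _ _ → k)
        ≡⟨ ∑-cong (λ _ → ∑-cong λ _ → ∑-cong λ _ → ∑-const n k) ⟩
      ∑ {n} (λ _ → ∑ {n} λ _ → ∑ {n} λ _ → + n * k)
        ≡⟨ ∑-cong (λ _ → ∑-cong λ _ → ∑-const n _) ⟩
      ∑ {n} (λ _ → ∑ {n} λ _ → + n * (+ n * k))
        ≡⟨ ∑-cong (λ _ → ∑-const n _) ⟩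
      ∑ {n} (λ _ → + n * (+ n * (+ n * k)))
        ≡⟨ ∑-const n _ ⟩
      + n * (+ n * (+ n * (+ n * k)))
        ≡⟨ reassociate (+ n) k ⟩
      -- The trailing `1ℤ` mirrors the unfolding of `n ^ 4` down to `n ^ 0`.
      + n * (+ n * (+ n * (+ n * 1ℤ))) * k
        ≡⟨ cong (_* k) pos-^4 ⟨
      + (n ^ 4) * k ∎
      where
      open ≡-Reasoning
      reassociate : ∀ x y → x * (x * (x * (x * y))) ≡ x * (x * (x * (x * 1ℤ))) * y
      reassociate = solve-∀
      pos-^4 : + (n ^ 4) ≡ + n * (+ n * (+ n * (+ n * 1ℤ)))
      pos-^4 =
        trans (ℤₚ.pos-* n _) (cong (+ n *_)
          (trans (ℤₚ.pos-* n _) (cong (+ n *_)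
            (trans (ℤₚ.pos-* n _) (cong (+ n *_) (ℤₚ.pos-* n 1))))))

    -- Bridge to the nested list sums by which `P4` is defined.
    ∑⁴-pos : (f : Fin n → Fin n → Fin n → Fin n → ℕ) →
             ∑⁴ (λ a b c d → + f a b c d) ≡
             + sum (map (λ a → sum (map (λ b → sum (map (λ c → sum (map (f a b c)
                 (allFin n))) (allFin n))) (allFin n))) (allFin n))
    ∑⁴-pos f =
      trans (∑-cong λ a →
        trans (∑-cong λ b →
          trans (∑-cong λ c → ∑-pos _) (∑-pos _))
        (∑-pos _))
      (∑-pos _)

    -- For fixed `a` and `b` the indices `c` and `d` vary independently, so the inner double sum
    -- factors as `k a b` times the square of `L a b`.
    ∑⁴-squares : (k : Fin n → Fin n → ℤ) (l : Fin n → Fin n → Fin n → ℤ) → (∀ a b → 0ℤ ℤ.≤ k a b) →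
                 0ℤ ℤ.≤ ∑⁴ (λ a b c d → k a b * (l a b c * l a b d))
    ∑⁴-squares {n} k l 0≤k = ∑-nonneg λ a → ∑-nonneg λ b → subst (0ℤ ℤ.≤_) (sym (factor a b)) (nonneg a b)
      where
      open ≡-Reasoning
      L : Fin n → Fin n → ℤ
      L a b = ∑ (l a b)
      factor : ∀ a b → ∑ (λ c → ∑ λ d → k a b * (l a b c * l a b d)) ≡ k a b * (L a b * L a b)
      factor a b = begin
        ∑ (λ c → ∑ λ d → k a b * (l a b c * l a b d))
          ≡⟨ ∑-cong (λ c → trans (cong (k a b *_) (*-∑ (l a b c) (l a b))) (*-∑ (k a b) _)) ⟨
        ∑ (λ c → k a b * (l a b c * L a b))
          ≡⟨ *-∑ (k a b) _ ⟨
        k a b * ∑ (λ c → l a b c * L a b)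
          ≡⟨ cong (k a b *_) (∑-* (L a b) (l a b)) ⟨
        k a b * (L a b * L a b) ∎
      square-nonneg : ∀ i → 0ℤ ℤ.≤ i * i
      square-nonneg (+ m)      = subst (0ℤ ℤ.≤_) (ℤₚ.pos-* m m) (ℤ.+≤+ ℕ.z≤n)
      square-nonneg ℤ.-[1+ m ] = ℤ.+≤+ ℕ.z≤n
      nonneg : ∀ a b → 0ℤ ℤ.≤ k a b * (L a b * L a b)
      nonneg a b = subst (ℤ._≤ k a b * (L a b * L a b)) (ℤₚ.*-zeroʳ (k a b))
        (ℤₚ.*-monoˡ-≤-nonNeg (k a b) {{ℤ.nonNegative (0≤k a b)}} (square-nonneg (L a b)))

  -- Averaging over the orderings of a quadruple

  infixl 6 _⊕_
  _⊕_ : Weight V → Weight V → Weight V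
  (f ⊕ g) a b c d = f a b c d + g a b c d

  τ₁ τ₂ τ₃ : Weight V → Weight V
  τ₁ f a b c d = f b a c d
  τ₂ f a b c d = f a c b d
  τ₃ f a b c d = f a b d c

  -- Each permutation of the arguments occurs exactly once: the factors run
  -- over the shortest coset representatives of S₂ ⊂ S₃ ⊂ S₄.
  symmetrise : Weight V → Weight V
  symmetrise f = h ⊕ τ₁ h ⊕ τ₂ (τ₁ h) ⊕ τ₃ (τ₂ (τ₁ h))
    where
    g = f ⊕ τ₃ f
    h = g ⊕ τ₂ g ⊕ τ₃ (τ₂ g)

  opaque
    unfolding ∑⁴

    ∑⁴-τ₁ : (f : Weight (Fin n)) → ∑⁴ (τ₁ f) ≡ ∑⁴ f
    ∑⁴-τ₁ f = ∑-swap _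

    ∑⁴-τ₂ : (f : Weight (Fin n)) → ∑⁴ (τ₂ f) ≡ ∑⁴ f
    ∑⁴-τ₂ f = ∑-cong λ a → ∑-swap _

    ∑⁴-τ₃ : (f : Weight (Fin n)) → ∑⁴ (τ₃ f) ≡ ∑⁴ f
    ∑⁴-τ₃ f = ∑-cong λ a → ∑-cong λ b → ∑-swap _

  -- Each adjacent transposition merely exchanges two neighbouring sums, so all summands have the
  -- same total; the three layers of cosets contribute 4 · 3 · 2 = 24 copies.
  ∑⁴-symmetrise : (f : Weight (Fin n)) → ∑⁴ (symmetrise f) ≡ + 24 * ∑⁴ f
  ∑⁴-symmetrise f = begin
    ∑⁴ (symmetrise f)
      ≡⟨ ⊕-cong (⊕-cong (⊕-cong refl (∑⁴-τ₁ h)) τ₂₁) (trans (∑⁴-τ₃ _) τ₂₁) ⟩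
    ∑⁴ h + ∑⁴ h + ∑⁴ h + ∑⁴ h
      ≡⟨ cong (λ x → x + x + x + x) (⊕-cong (⊕-cong refl (∑⁴-τ₂ g)) (trans (∑⁴-τ₃ _) (∑⁴-τ₂ g))) ⟩
    _ ≡⟨ cong (λ y → let x = y + y + y in x + x + x + x) (⊕-cong refl (∑⁴-τ₃ f)) ⟩
    _ ≡⟨ collect (∑⁴ f) ⟩
    + 24 * ∑⁴ f ∎
    where
    open ≡-Reasoning
    g = f ⊕ τ₃ f
    h = g ⊕ τ₂ g ⊕ τ₃ (τ₂ g)
    ⊕-cong : ∀ {f g : Weight (Fin n)} {x y} → ∑⁴ f ≡ x → ∑⁴ g ≡ y → ∑⁴ (f ⊕ g) ≡ x + y
    ⊕-cong {f = f} {g = g} p q = trans (∑⁴-+ f g) (cong₂ ℤ._+_ p q)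
    τ₂₁ : ∑⁴ (τ₂ (τ₁ h)) ≡ ∑⁴ h
    τ₂₁ = trans (∑⁴-τ₂ _) (∑⁴-τ₁ h)
    collect : ∀ z → (let y = z + z; x = y + y + y in x + x + x + x) ≡ + 24 * z
    collect = solve-∀

-- The sum-of-squares certificate

module _ where
  open Data.Integer using (_+_; _*_; _-_)

  ⟦_⟧ : Bool → ℤ
  ⟦ b ⟧ = + count b

  ⟦⟧-nonneg : ∀ b → 0ℤ ℤ.≤ ⟦ b ⟧
  ⟦⟧-nonneg _ = ℤ.+≤+ ℕ.z≤n

  module Certificate (_⇒_ : V → V → Bool) where

    _∼_ : V → V → Bool
    a ∼ b = (a ⇒ b) ∨ (b ⇒ a)

    path : V → V → V → V → Bool
    path a b c d = (a ⇒ b) ∧ (b ⇒ c) ∧ (c ⇒ d)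

    -- Reversing all edges and exchanging `a` and `b` negates `imbalance`, so its square shares the
    -- reversal symmetry of the path count. `mixing` is 0, 1 or -1 according to whether `c` is
    -- adjacent to neither, exactly one or both of `a` and `b`.
    imbalance mixing : V → V → V → ℤ
    imbalance a b c = ⟦ (c ⇒ a) ∧ not (b ∼ c) ⟧ - ⟦ (b ⇒ c) ∧ not (a ∼ c) ⟧
    mixing a b c = ⟦ a ∼ c ⟧ + ⟦ b ∼ c ⟧ - + 3 * ⟦ (a ∼ c) ∧ (b ∼ c) ⟧

    edgeSquare nonedgeSquare slack : Weight V
    edgeSquare    a b c d = ⟦ a ⇒ b ⟧ * (imbalance a b c * imbalance a b d)
    nonedgeSquare a b c d = ⟦ not (a ∼ b) ⟧ * (mixing a b c * mixing a b d)
    slack a b c d =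
      + 16 - + 300 * ⟦ path a b c d ⟧ - + 126 * edgeSquare a b c d - + 21 * nonedgeSquare a b c d

open Certificate

-- Exhaustive check on four vertices

Entries : Set
Entries = Vec Bool 12

matrix : Entries → Fin 4 → Fin 4 → Bool
matrix (ab ∷ ba ∷ ac ∷ ca ∷ ad ∷ da ∷ bc ∷ cb ∷ bd ∷ db ∷ cd ∷ dc ∷ []) = λ where
  0F 1F → ab
  1F 0F → ba
  0F 2F → ac
  2F 0F → ca
  0F 3F → ad
  3F 0F → da
  1F 2F → bc
  2F 1F → cb
  1F 3F → bd
  3F 1F → db
  2F 3F → cd
  3F 2F → dc
  -- Only the diagonal reaches this clause.
  _  _  → false

no2Cycle : (V → V → Bool) → V → V → Bool
no2Cycle e a b = not (e a b ∧ e b a)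

no3Cycle : (V → V → Bool) → V → V → V → Bool
no3Cycle e a b c = not (e a b ∧ e b c ∧ e c a) ∧ not (e a c ∧ e c b ∧ e b a)

3free₄ : (V → V → Bool) → V → V → V → V → Bool
3free₄ e a b c d =
  (no2Cycle e a b ∧ no2Cycle e a c ∧ no2Cycle e a d ∧ no2Cycle e b c ∧ no2Cycle e b d ∧ no2Cycle e c d) ∧
  (no3Cycle e a b c ∧ no3Cycle e a b d ∧ no3Cycle e a c d ∧ no3Cycle e b c d)

-- A Boolean quantifier, so that `refl` can settle all 2^12 adjacency patterns by evaluation.
forallᵇ : ∀ k → (Vec Bool k → Bool) → Bool
forallᵇ ℕ.zero    p = p []
forallᵇ (ℕ.suc k) p = forallᵇ k (p ∘ (true ∷_)) ∧ forallᵇ k (p ∘ (false ∷_))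

-- An implication: patterns that are not 3-free pass by the first disjunct.
slackNonneg : Entries → Bool
slackNonneg xs = not (3free₄ m 0F 1F 2F 3F) ∨ (0ℤ ≤ᵇ symmetrise (slack m) 0F 1F 2F 3F)
  where m = matrix xs

forallᵇ-sound : ∀ k (p : Vec Bool k → Bool) → forallᵇ k p ≡ true → ∀ xs → p xs ≡ true
forallᵇ-sound ℕ.zero    p h []           = h
forallᵇ-sound (ℕ.suc k) p h (true  ∷ xs) = forallᵇ-sound k _ (∧-conicalˡ _ _ h) xs
forallᵇ-sound (ℕ.suc k) p h (false ∷ xs) = forallᵇ-sound k _ (∧-conicalʳ _ _ h) xs

-- Transfer to an arbitrary 3-free digraph

module _ (G : Digraph n) (3free : ThreeFree G) where

  no2Cycle-E : ∀ a b → no2Cycle (E G) a b ≡ true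
  no2Cycle-E a b with E G a b in ab | E G b a in ba
  ... | false | _     = refl
  ... | true  | false = refl
  ... | true  | true  = ⊥-elim (proj₁ 3free a b ab ba)

  noTriangle : ∀ a b c → not (E G a b ∧ E G b c ∧ E G c a) ≡ true
  noTriangle a b c with E G a b in ab | E G b c in bc | E G c a in ca
  ... | false | _     | _     = refl
  ... | true  | false | _     = refl
  ... | true  | true  | false = refl
  ... | true  | true  | true  = ⊥-elim (proj₂ 3free a b c ab bc ca)

  no3Cycle-E : ∀ a b c → no3Cycle (E G) a b c ≡ true
  no3Cycle-E a b c = cong₂ _∧_ (noTriangle a b c) (noTriangle a c b)

  -- `ThreeFree` quantifies over all vertices, equal ones included, so quadruples with repetitions
  -- are covered.
  3free₄-E : ∀ a b c d → 3free₄ (E G) a b c d ≡ true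
  3free₄-E a b c d = cong₂ _∧_
    (cong₂ _∧_ (no2Cycle-E a b) (cong₂ _∧_ (no2Cycle-E a c) (cong₂ _∧_ (no2Cycle-E a d)
      (cong₂ _∧_ (no2Cycle-E b c) (cong₂ _∧_ (no2Cycle-E b d) (no2Cycle-E c d))))))
    (cong₂ _∧_ (no3Cycle-E a b c) (cong₂ _∧_ (no3Cycle-E a b d)
      (cong₂ _∧_ (no3Cycle-E a c d) (no3Cycle-E b c d))))

  -- slack never inspects the diagonal, so the two values of symmetrise, at a b c d and at the
  -- tabulated matrix, unfold to the same term.
  symmetrise-slack-nonneg : ∀ a b c d → 0ℤ ℤ.≤ symmetrise (slack (E G)) a b c d
  symmetrise-slack-nonneg a b c d = ℤₚ.≤ᵇ⇒≤ (Equivalence.from T-≡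
    (trans (cong (λ x → not x ∨ (0ℤ ≤ᵇ symmetrise (slack (E G)) a b c d)) (sym (3free₄-E a b c d)))
           (forallᵇ-sound 12 slackNonneg refl entries)))
    where
    _⇒_ = E G
    entries : Entries
    entries = (a ⇒ b) ∷ (b ⇒ a) ∷ (a ⇒ c) ∷ (c ⇒ a) ∷ (a ⇒ d) ∷ (d ⇒ a)
            ∷ (b ⇒ c) ∷ (c ⇒ b) ∷ (b ⇒ d) ∷ (d ⇒ b) ∷ (c ⇒ d) ∷ (d ⇒ c) ∷ []

  -- A single value of `slack` can be negative, for example along an induced path; nonnegativity
  -- comes from the sum over all 24 orderings.
  ∑⁴-slack-nonneg : 0ℤ ℤ.≤ ∑⁴ (slack (E G))
  ∑⁴-slack-nonneg = ℤₚ.*-cancelˡ-≤-pos 0ℤ _ (+ 24)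
    (subst (0ℤ ℤ.≤_) (∑⁴-symmetrise _) (∑⁴-nonneg symmetrise-slack-nonneg))

  300*paths≤16*n⁴ : + 300 ℤ.* ∑⁴ (λ a b c d → ⟦ path (E G) a b c d ⟧) ℤ.≤ + (n ^ 4) ℤ.* + 16
  300*paths≤16*n⁴ = begin
    + 300 * ∑⁴ p
      ≡⟨ +-zeros (+ 300 * ∑⁴ p) ⟨
    -- The zeros are placeholders, replaced next by the two scaled sums of squares and the sum of
    -- `slack`.
    + 300 * ∑⁴ p + 0ℤ + 0ℤ + 0ℤ
      ≤⟨ ℤₚ.+-mono-≤ (ℤₚ.+-mono-≤ (ℤₚ.+-monoʳ-≤ (+ 300 * ∑⁴ p) (scaled 126 s₁≥0)) (scaled 21 s₂≥0)) ∑⁴-slack-nonneg ⟩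
    + 300 * ∑⁴ p + + 126 * ∑⁴ s₁ + + 21 * ∑⁴ s₂ + ∑⁴ s₀
      ≡⟨ cong (_+ ∑⁴ s₀) (cong₂ ℤ._+_ (cong₂ ℤ._+_ (*-∑⁴ (+ 300) p) (*-∑⁴ (+ 126) s₁)) (*-∑⁴ (+ 21) s₂)) ⟩
    ∑⁴ (300 · p) + ∑⁴ (126 · s₁) + ∑⁴ (21 · s₂) + ∑⁴ s₀
      ≡⟨ cong (λ x → x + ∑⁴ (21 · s₂) + ∑⁴ s₀) (∑⁴-+ (300 · p) (126 · s₁)) ⟨
    ∑⁴ (300 · p ⊕ 126 · s₁) + ∑⁴ (21 · s₂) + ∑⁴ s₀
      ≡⟨ cong (_+ ∑⁴ s₀) (∑⁴-+ (300 · p ⊕ 126 · s₁) (21 · s₂)) ⟨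
    ∑⁴ (300 · p ⊕ 126 · s₁ ⊕ 21 · s₂) + ∑⁴ s₀
      ≡⟨ ∑⁴-+ (300 · p ⊕ 126 · s₁ ⊕ 21 · s₂) s₀ ⟨
    ∑⁴ (300 · p ⊕ 126 · s₁ ⊕ 21 · s₂ ⊕ s₀)
      -- By the definition of `slack`, everything but the constant 16 cancels at each quadruple.
      ≤⟨ ∑⁴-mono (λ a b c d → ℤₚ.≤-reflexive (cancel (p a b c d) (s₁ a b c d) (s₂ a b c d))) ⟩
    ∑⁴ {n} (λ _ _ _ _ → + 16)
      ≡⟨ ∑⁴-const n (+ 16) ⟩
    + (n ^ 4) * + 16 ∎
    where
    open ℤₚ.≤-Reasoning
    open Data.Integer using (_+_; _*_; _-_)
    infixr 7 _·_
    _·_ : ℕ → Weight (Fin n) → Weight (Fin n)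
    (k · f) a b c d = + k * f a b c d
    p s₀ s₁ s₂ : Weight (Fin n)
    p a b c d = ⟦ path (E G) a b c d ⟧
    s₀ = slack (E G)
    s₁ = edgeSquare (E G)
    s₂ = nonedgeSquare (E G)
    s₁≥0 : 0ℤ ℤ.≤ ∑⁴ s₁
    s₁≥0 = ∑⁴-squares (λ a b → ⟦ E G a b ⟧) (imbalance (E G)) λ a b → ⟦⟧-nonneg (E G a b)
    s₂≥0 : 0ℤ ℤ.≤ ∑⁴ s₂
    s₂≥0 = ∑⁴-squares (λ a b → ⟦ not (_∼_ (E G) a b) ⟧) (mixing (E G)) λ a b → ⟦⟧-nonneg (not (_∼_ (E G) a b))
    scaled : ∀ k {x} → 0ℤ ℤ.≤ x → 0ℤ ℤ.≤ + k * x
    scaled k {x} 0≤x = subst (ℤ._≤ + k * x) (ℤₚ.*-zeroʳ (+ k)) (ℤₚ.*-monoˡ-≤-nonNeg (+ k) 0≤x)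
    +-zeros : ∀ x → x + 0ℤ + 0ℤ + 0ℤ ≡ x
    +-zeros = solve-∀
    cancel : ∀ x y z → + 300 * x + + 126 * y + + 21 * z + (+ 16 - + 300 * x - + 126 * y - + 21 * z) ≡ + 16
    cancel = solve-∀

-- From walks to paths, and the final bound

count-∧ : ∀ x y → count (x ∧ y) ℕ.≤ count y
count-∧ true  y = ℕₚ.≤-refl
count-∧ false y = ℕ.z≤n

isP4≤path : (G : Digraph n) → ∀ a b c d → count (isP4 G a b c d) ℕ.≤ count (path (E G) a b c d)
isP4≤path G a b c d =
  drop (distinct a b) (drop (distinct a c) (drop (distinct a d)
    (drop (distinct b c) (drop (distinct b d) (drop (distinct c d) ℕₚ.≤-refl)))))
  where
  drop : ∀ x {y k} → count y ℕ.≤ k → count (x ∧ y) ℕ.≤ k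
  drop x = ℕₚ.≤-trans (count-∧ x _)

P4≤paths : (G : Digraph n) → + P4 G ℤ.≤ ∑⁴ (λ a b c d → ⟦ path (E G) a b c d ⟧)
P4≤paths G = subst (ℤ._≤ ∑⁴ (λ a b c d → ⟦ path (E G) a b c d ⟧)) (∑⁴-pos (λ a b c d → count (isP4 G a b c d))) (∑⁴-mono λ a b c d → ℤ.+≤+ (isP4≤path G a b c d))

open import Data.Nat using (_*_; _≤_)

theorem4p1 : (n : ℕ) (G : Digraph n) → ThreeFree G → 75 * P4 G ≤ 4 * n ^ 4
-- Multiplying by 4 matches the integer certificate: 4 · 75 = 300 and 4 · 4 = 16.
theorem4p1 n G 3free = ℕₚ.*-cancelˡ-≤ 4 (ℤₚ.drop‿+≤+ (begin
  + (4 * (75 * P4 G))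
    ≡⟨ cong +_ (ℕₚ.*-assoc 4 75 (P4 G)) ⟨
  + (300 * P4 G)
    ≡⟨ ℤₚ.pos-* 300 (P4 G) ⟩
  + 300 ℤ.* + P4 G
    ≤⟨ ℤₚ.*-monoˡ-≤-nonNeg (+ 300) (P4≤paths G) ⟩
  + 300 ℤ.* ∑⁴ (λ a b c d → ⟦ path (E G) a b c d ⟧)
    ≤⟨ 300*paths≤16*n⁴ G 3free ⟩
  + (n ^ 4) ℤ.* + 16
    ≡⟨ ℤₚ.pos-* (n ^ 4) 16 ⟨
  + (n ^ 4 * 16)
    ≡⟨ cong +_ (trans (ℕₚ.*-comm (n ^ 4) 16) (ℕₚ.*-assoc 4 4 (n ^ 4))) ⟩
  + (4 * (4 * n ^ 4)) ∎))
  where open ℤₚ.≤-Reasoning
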